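{- For every integer $m\ge 0$, $$C_{m}^2=\sum_{k=0}^{m}\frac{(2k+2)\big((2k+1)(2k+3)-(2m+1)\big)}{(2m+1)(2m+2)^2}\binom{2m+2}{m-k}^2.$$
   Context: $C_m=\frac{1}{m+1}\binom{2m}{m}$ is the $m$-th Catalan number. -}

module Defs where

open import Data.Integer.Base using (+_)
open import Data.Nat.Base as ℕ using (ℕ; suc)
open import Data.Nat.Combinatorics using (_C_)
open import Data.Rational.Base using (ℚ; _/_)
open import Data.Rational.Properties using (+-0-monoid)

-- ∑[ i ≤ n ] f i : the sum in ℚ over i : Fin (suc n), i.e. over 0, …, n inclusive.
open import Algebra.Properties.Monoid.Sum +-0-monoid public using (sum⁺-syntax)

catalan : ℕ → ℚ
catalan m = (+ ((2 ℕ.* m) C m)) / suc m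

{-# OPTIONS --safe #-}

-- The sum telescopes.  Put b k = ((2k+1) (m+1-k) C(2m+2, m+1-k))² / ((2m+1) D) with D = (2m+1)(2m+2)²;
-- the k-th summand is b k - b (k+1), because (m+1-k) C(2m+2, m+1-k) = (m+k+2) C(2m+2, m-k) turns this
-- into a polynomial identity.  Here b (m+1) = 0, and b 0 = C_m² by
-- (m+1)² C(2m+2, m+1) = (2m+1)(2m+2) C(2m, m).
module Submission where

open import Defs
open import Data.Fin.Base using (Fin; toℕ) renaming (zero to fzero; suc to fsuc)
open import Data.Fin.Properties using (toℕ≤pred[n])
open import Data.Integer.Base as ℤ using (ℤ; +_)
import Data.Integer.Properties as ℤ
import Data.Integer.Tactic.RingSolver as ℤ-Solver
open import Data.Nat.Base as ℕ using (ℕ; _∸_; zero; suc; NonZero)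
open import Data.Nat.Combinatorics using (_C_; nC1≡n; k>n⇒nCk≡0; nCk+nC[k+1]≡[n+1]C[k+1])
import Data.Nat.Properties as ℕ
import Data.Nat.Tactic.RingSolver as ℕ-Solver
open import Data.Rational.Base using (ℚ; 0ℚ; _*_; _+_; _/_; toℚᵘ; fromℚᵘ)
import Data.Rational.Properties as ℚ
open import Algebra.Properties.Monoid.Sum ℚ.+-0-monoid using (sum)
open import Data.Rational.Unnormalised.Base as ℚᵘ using (mkℚᵘ; *≡*)
import Data.Rational.Unnormalised.Properties as ℚᵘ
open import Function.Base using (_∘_)
open import Relation.Binary.PropositionalEquality
  using (_≡_; refl; sym; trans; cong; cong₂; module ≡-Reasoning)

-- Ratios of neighbouring binomial coefficients

-- Absorption, by induction on the row: Pascal's rule splits the left side, both pieces fall to row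
-- `n′`, and Pascal's rule reassembles them.
[1+k]*[1+n]C[1+k]≡[1+n]*nCk : ∀ n k → suc k ℕ.* (suc n C suc k) ≡ suc n ℕ.* (n C k)
[1+k]*[1+n]C[1+k]≡[1+n]*nCk n zero = begin
  1 ℕ.* (suc n C 1)  ≡⟨ ℕ.*-identityˡ _ ⟩
  suc n C 1          ≡⟨ nC1≡n (suc n) ⟩
  suc n              ≡⟨ ℕ.*-identityʳ _ ⟨
  suc n ℕ.* 1        ∎
  where open ≡-Reasoning
[1+k]*[1+n]C[1+k]≡[1+n]*nCk zero k@(suc _) = begin
  suc k ℕ.* (1 C suc k)  ≡⟨ cong (suc k ℕ.*_) (k>n⇒nCk≡0 {1} {suc k} (ℕ.s<s ℕ.z<s)) ⟩
  suc k ℕ.* 0            ≡⟨ ℕ.*-zeroʳ (suc k) ⟩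
  0                      ≡⟨ cong (1 ℕ.*_) (k>n⇒nCk≡0 {0} {k} ℕ.z<s) ⟨
  1 ℕ.* (0 C k)          ∎
  where open ≡-Reasoning
[1+k]*[1+n]C[1+k]≡[1+n]*nCk n@(suc n′) k@(suc k′) = begin
  suc k ℕ.* (suc n C suc k)
    ≡⟨ cong (suc k ℕ.*_) (nCk+nC[k+1]≡[n+1]C[k+1] n k) ⟨
  suc k ℕ.* (n C k ℕ.+ n C suc k)
    ≡⟨ ℕ.*-distribˡ-+ (suc k) (n C k) (n C suc k) ⟩
  (n C k ℕ.+ k ℕ.* (n C k)) ℕ.+ suc k ℕ.* (n C suc k)
    ≡⟨ ℕ.+-assoc (n C k) _ _ ⟩
  n C k ℕ.+ (k ℕ.* (n C k) ℕ.+ suc k ℕ.* (n C suc k))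
    ≡⟨ cong (n C k ℕ.+_) (cong₂ ℕ._+_ ([1+k]*[1+n]C[1+k]≡[1+n]*nCk n′ k′)
                                      ([1+k]*[1+n]C[1+k]≡[1+n]*nCk n′ k)) ⟩
  n C k ℕ.+ (n ℕ.* (n′ C k′) ℕ.+ n ℕ.* (n′ C k))
    ≡⟨ cong (n C k ℕ.+_) (ℕ.*-distribˡ-+ n (n′ C k′) (n′ C k)) ⟨
  n C k ℕ.+ n ℕ.* (n′ C k′ ℕ.+ n′ C k)
    ≡⟨ cong (λ x → n C k ℕ.+ n ℕ.* x) (nCk+nC[k+1]≡[n+1]C[k+1] n′ k′) ⟩
  suc n ℕ.* (n C k)
    ∎
  where open ≡-Reasoning

-- Adding `suc k * (n C k)` to both sides turns this into Pascal's rule followed by absorption. The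
-- index `j` stands for n - k without truncated subtraction.
[1+k]*nC[1+k]≡j*nCk : ∀ {n} k j → k ℕ.+ j ≡ n → suc k ℕ.* (n C suc k) ≡ j ℕ.* (n C k)
[1+k]*nC[1+k]≡j*nCk {n} k j refl = ℕ.+-cancelˡ-≡ (suc k ℕ.* (n C k)) _ _ (begin
  suc k ℕ.* (n C k) ℕ.+ suc k ℕ.* (n C suc k)  ≡⟨ ℕ.*-distribˡ-+ (suc k) (n C k) _ ⟨
  suc k ℕ.* (n C k ℕ.+ n C suc k)              ≡⟨ cong (suc k ℕ.*_) (nCk+nC[k+1]≡[n+1]C[k+1] n k) ⟩
  suc k ℕ.* (suc n C suc k)                    ≡⟨ [1+k]*[1+n]C[1+k]≡[1+n]*nCk n k ⟩
  (suc k ℕ.+ j) ℕ.* (n C k)                    ≡⟨ ℕ.*-distribʳ-+ (n C k) (suc k) j ⟩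
  suc k ℕ.* (n C k) ℕ.+ j ℕ.* (n C k)          ∎)
  where open ≡-Reasoning

central-binomial-step : ∀ m →
  suc m ℕ.* (suc m ℕ.* ((2 ℕ.* m ℕ.+ 2) C suc m)) ≡
  (1 ℕ.+ 2 ℕ.* m) ℕ.* ((2 ℕ.+ 2 ℕ.* m) ℕ.* ((2 ℕ.* m) C m))
central-binomial-step m = begin
  suc m ℕ.* (suc m ℕ.* ((2 ℕ.* m ℕ.+ 2) C suc m))
    ≡⟨ cong (λ n → suc m ℕ.* (suc m ℕ.* (n C suc m))) (ℕ.+-comm (2 ℕ.* m) 2) ⟩
  suc m ℕ.* (suc m ℕ.* (suc 1+2m C suc m))
    ≡⟨ cong (suc m ℕ.*_) ([1+k]*[1+n]C[1+k]≡[1+n]*nCk 1+2m m) ⟩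
  suc m ℕ.* (suc 1+2m ℕ.* (1+2m C m))
    ≡⟨ x∙yz≈y∙xz (suc m) (suc 1+2m) (1+2m C m) ⟩
  suc 1+2m ℕ.* (suc m ℕ.* (1+2m C m))
    -- Row 1+2m has its two middle entries at m and m+1, with the same multiplier `suc m`; moving to
    -- the second lets absorption descend to row 2m.
    ≡⟨ cong (suc 1+2m ℕ.*_) ([1+k]*nC[1+k]≡j*nCk m (suc m) (m+[1+m]≡1+2m m)) ⟨
  suc 1+2m ℕ.* (suc m ℕ.* (1+2m C suc m))
    ≡⟨ cong (suc 1+2m ℕ.*_) ([1+k]*[1+n]C[1+k]≡[1+n]*nCk (2 ℕ.* m) m) ⟩
  suc 1+2m ℕ.* (1+2m ℕ.* ((2 ℕ.* m) C m))
    ≡⟨ x∙yz≈y∙xz (suc 1+2m) 1+2m ((2 ℕ.* m) C m) ⟩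
  1+2m ℕ.* (suc 1+2m ℕ.* ((2 ℕ.* m) C m))
    ∎
  where
  open ≡-Reasoning
  open import Algebra.Properties.CommutativeSemigroup ℕ.*-commutativeSemigroup using (x∙yz≈y∙xz)

  1+2m : ℕ
  1+2m = suc (2 ℕ.* m)

  m+[1+m]≡1+2m : ∀ m → m ℕ.+ suc m ≡ suc (2 ℕ.* m)
  m+[1+m]≡1+2m = ℕ-Solver.solve-∀

-- Telescoping sums

sum-telescope : ∀ n (t : Fin n → ℚ) (b : ℕ → ℚ) →
  (∀ i → t i + b (suc (toℕ i)) ≡ b (toℕ i)) →
  sum t + b n ≡ b 0
sum-telescope zero    t b step = ℚ.+-identityˡ (b 0)
sum-telescope (suc n) t b step = begin
  (t fzero + ∑tail) + b (suc n)  ≡⟨ ℚ.+-assoc (t fzero) ∑tail (b (suc n)) ⟩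
  t fzero + (∑tail + b (suc n))  ≡⟨ cong (λ x → t fzero + x) (sum-telescope n (t ∘ fsuc) (b ∘ suc) (step ∘ fsuc)) ⟩
  t fzero + b 1                  ≡⟨ step fzero ⟩
  b 0                               ∎
  where
  open ≡-Reasoning
  ∑tail = sum (t ∘ fsuc)

-- Arithmetic of fractions

fromℚᵘ-homo-* : ∀ p q → fromℚᵘ p * fromℚᵘ q ≡ fromℚᵘ (p ℚᵘ.* q)
fromℚᵘ-homo-* p q = ℚ.toℚᵘ-injective (begin
  toℚᵘ (fromℚᵘ p * fromℚᵘ q)             ≈⟨ ℚ.toℚᵘ-homo-* (fromℚᵘ p) (fromℚᵘ q) ⟩
  toℚᵘ (fromℚᵘ p) ℚᵘ.* toℚᵘ (fromℚᵘ q)   ≈⟨ ℚᵘ.*-cong (ℚ.toℚᵘ-fromℚᵘ p) (ℚ.toℚᵘ-fromℚᵘ q) ⟩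
  p ℚᵘ.* q                               ≈⟨ ℚ.toℚᵘ-fromℚᵘ (p ℚᵘ.* q) ⟨
  toℚᵘ (fromℚᵘ (p ℚᵘ.* q))               ∎)
  where open import Relation.Binary.Reasoning.Setoid ℚᵘ.≃-setoid

fromℚᵘ-homo-+ : ∀ p q → fromℚᵘ p + fromℚᵘ q ≡ fromℚᵘ (p ℚᵘ.+ q)
fromℚᵘ-homo-+ p q = ℚ.toℚᵘ-injective (begin
  toℚᵘ (fromℚᵘ p + fromℚᵘ q)             ≈⟨ ℚ.toℚᵘ-homo-+ (fromℚᵘ p) (fromℚᵘ q) ⟩
  toℚᵘ (fromℚᵘ p) ℚᵘ.+ toℚᵘ (fromℚᵘ q)   ≈⟨ ℚᵘ.+-cong (ℚ.toℚᵘ-fromℚᵘ p) (ℚ.toℚᵘ-fromℚᵘ q) ⟩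
  p ℚᵘ.+ q                               ≈⟨ ℚ.toℚᵘ-fromℚᵘ (p ℚᵘ.+ q) ⟨
  toℚᵘ (fromℚᵘ (p ℚᵘ.+ q))               ∎)
  where open import Relation.Binary.Reasoning.Setoid ℚᵘ.≃-setoid

/-cross : ∀ p q m n .{{_ : NonZero m}} .{{_ : NonZero n}} →
  p ℤ.* + n ≡ q ℤ.* + m → p / m ≡ q / n
-- With the denominators exposed as successors, `p / suc m` is `fromℚᵘ (mkℚᵘ p m)` by unfolding.
/-cross p q (suc m) (suc n) eq = ℚ.fromℚᵘ-cong {mkℚᵘ p m} {mkℚᵘ q n} (*≡* eq)

/-*-/ : ∀ p q m n .{{_ : NonZero m}} .{{_ : NonZero n}} →
  (p / m) * (q / n) ≡ ((p ℤ.* q) / (m ℕ.* n)) {{ℕ.m*n≢0 m n}}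
/-*-/ p q (suc m) (suc n) = fromℚᵘ-homo-* (mkℚᵘ p m) (mkℚᵘ q n)

/-+-/ : ∀ p q n .{{_ : NonZero n}} → (p / n) + (q / n) ≡ (p ℤ.+ q) / n
/-+-/ p q n@(suc n-1) = trans (fromℚᵘ-homo-+ (mkℚᵘ p n-1) (mkℚᵘ q n-1))
  -- Unnormalised addition leaves the denominator `n * n`; one factor `n` has to be cancelled.
  (/-cross (p ℤ.* + n ℤ.+ q ℤ.* + n) (p ℤ.+ q) (n ℕ.* n) n
    (trans (lemma p q (+ n)) (cong ((p ℤ.+ q) ℤ.*_) (sym (ℤ.pos-* n n)))))
  where
  lemma : ∀ p q n → (p ℤ.* n ℤ.+ q ℤ.* n) ℤ.* n ≡ (p ℤ.+ q) ℤ.* (n ℤ.* n)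
  lemma = ℤ-Solver.solve-∀

-- The summand as a difference of boundary terms

-- This and the next two definitions copy the expressions of the theorem literally, so that its sum
-- is matched by unfolding alone.
denominator : ℕ → ℕ
denominator m = (1 ℕ.+ 2 ℕ.* m) ℕ.* (2 ℕ.+ 2 ℕ.* m) ℕ.^ 2

coefficient : ℕ → ℕ → ℤ
coefficient m k = + (2 ℕ.* k ℕ.+ 2) ℤ.* (+ (2 ℕ.* k ℕ.+ 1) ℤ.* + (2 ℕ.* k ℕ.+ 3) ℤ.- + (2 ℕ.* m ℕ.+ 1))

summand : ℕ → ℕ → ℚ
summand m k = (coefficient m k / denominator m) * (+ (((2 ℕ.* m ℕ.+ 2) C (m ∸ k)) ℕ.^ 2) / 1)

boundaryRoot : ℕ → ℕ → ℤ
boundaryRoot m k = + (2 ℕ.* k ℕ.+ 1) ℤ.* + ((suc m ∸ k) ℕ.* ((2 ℕ.* m ℕ.+ 2) C (suc m ∸ k)))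

boundary : ℕ → ℕ → ℚ
boundary m k = (boundaryRoot m k ℤ.* boundaryRoot m k) / ((1 ℕ.+ 2 ℕ.* m) ℕ.* denominator m)

pos-^2 : ∀ n → + (n ℕ.^ 2) ≡ + n ℤ.* + n
pos-^2 n = trans (cong (λ x → + (n ℕ.* x)) (ℕ.*-identityʳ n)) (ℤ.pos-* n n)

[1+m∸k]*C-shift : ∀ m k → k ℕ.≤ m →
  (suc m ∸ k) ℕ.* ((2 ℕ.* m ℕ.+ 2) C (suc m ∸ k)) ≡
  (2 ℕ.+ 2 ℕ.* k ℕ.+ (m ∸ k)) ℕ.* ((2 ℕ.* m ℕ.+ 2) C (m ∸ k))
[1+m∸k]*C-shift m k k≤m = trans
  (cong (λ j → j ℕ.* ((2 ℕ.* m ℕ.+ 2) C j)) (ℕ.+-∸-assoc 1 k≤m))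
  -- The cofactor is (2m+2) - (m-k) = m+k+2, written as 2+2k+(m-k) to avoid subtracting.
  ([1+k]*nC[1+k]≡j*nCk (m ∸ k) (2 ℕ.+ 2 ℕ.* k ℕ.+ (m ∸ k))
    (trans (index k (m ∸ k)) (cong (λ n → 2 ℕ.* n ℕ.+ 2) (ℕ.m+[n∸m]≡n k≤m))))
  where
  index : ∀ k r → r ℕ.+ (2 ℕ.+ 2 ℕ.* k ℕ.+ r) ≡ 2 ℕ.* (k ℕ.+ r) ℕ.+ 2
  index = ℕ-Solver.solve-∀

-- With r = m-k, factor v² - u²: here v + u = (2m+1)(2k+2)b and v - u = ((2k+1)(2k+3) - (2m+1))b,
-- which together give the coefficient, the extra 2m+1 and b².
coefficient-difference-of-squares : ∀ {m} k r b → k ℕ.+ r ≡ m →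
  let u = + (2 ℕ.* suc k ℕ.+ 1) ℤ.* + (r ℕ.* b)
      v = + (2 ℕ.* k ℕ.+ 1) ℤ.* + ((2 ℕ.+ 2 ℕ.* k ℕ.+ r) ℕ.* b)
  in + (1 ℕ.+ 2 ℕ.* m) ℤ.* (coefficient m k ℤ.* + (b ℕ.^ 2)) ℤ.+ u ℤ.* u ≡ v ℤ.* v
coefficient-difference-of-squares {m} k r b refl = begin
  s ℤ.* (coefficient m k ℤ.* + (b ℕ.^ 2)) ℤ.+ square (p ℤ.* + (r ℕ.* b))
    ≡⟨ cong₂ (λ x y → s ℤ.* (coefficient m k ℤ.* x) ℤ.+ square (p ℤ.* y)) (pos-^2 b) (ℤ.pos-* r b) ⟩
  s ℤ.* (coefficient m k ℤ.* (+ b ℤ.* + b)) ℤ.+ square (p ℤ.* (+ r ℤ.* + b))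
    ≡⟨ identity (+ k) (+ r) (+ b) ⟩
  square (q ℤ.* (+ w ℤ.* + b))
    ≡⟨ cong (λ y → square (q ℤ.* y)) (ℤ.pos-* w b) ⟨
  square (q ℤ.* + (w ℕ.* b))
    ∎
  where
  open ≡-Reasoning
  s = + (1 ℕ.+ 2 ℕ.* m)
  p = + (2 ℕ.* suc k ℕ.+ 1)
  q = + (2 ℕ.* k ℕ.+ 1)
  w = 2 ℕ.+ 2 ℕ.* k ℕ.+ r

  square : ℤ → ℤ
  square x = x ℤ.* x

  -- 2 * n unfolds to n + (n + 0) in ℕ; writing it so in ℤ lets + commute with it definitionally.
  identity : ∀ k r b →
    (+ 1 ℤ.+ ((k ℤ.+ r) ℤ.+ ((k ℤ.+ r) ℤ.+ + 0))) ℤ.*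
      (((k ℤ.+ (k ℤ.+ + 0)) ℤ.+ + 2) ℤ.*
        (((k ℤ.+ (k ℤ.+ + 0)) ℤ.+ + 1) ℤ.* ((k ℤ.+ (k ℤ.+ + 0)) ℤ.+ + 3)
          ℤ.- (((k ℤ.+ r) ℤ.+ ((k ℤ.+ r) ℤ.+ + 0)) ℤ.+ + 1))
        ℤ.* (b ℤ.* b))
      ℤ.+ ((((+ 1 ℤ.+ k) ℤ.+ ((+ 1 ℤ.+ k) ℤ.+ + 0)) ℤ.+ + 1) ℤ.* (r ℤ.* b)) ℤ.*
          ((((+ 1 ℤ.+ k) ℤ.+ ((+ 1 ℤ.+ k) ℤ.+ + 0)) ℤ.+ + 1) ℤ.* (r ℤ.* b))
    ≡ (((k ℤ.+ (k ℤ.+ + 0)) ℤ.+ + 1) ℤ.* ((+ 2 ℤ.+ (k ℤ.+ (k ℤ.+ + 0)) ℤ.+ r) ℤ.* b)) ℤ.*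
      (((k ℤ.+ (k ℤ.+ + 0)) ℤ.+ + 1) ℤ.* ((+ 2 ℤ.+ (k ℤ.+ (k ℤ.+ + 0)) ℤ.+ r) ℤ.* b))
  identity = ℤ-Solver.solve-∀

boundaryRoot-step : ∀ m k → k ℕ.≤ m →
  + (1 ℕ.+ 2 ℕ.* m) ℤ.* (coefficient m k ℤ.* + (((2 ℕ.* m ℕ.+ 2) C (m ∸ k)) ℕ.^ 2))
    ℤ.+ boundaryRoot m (suc k) ℤ.* boundaryRoot m (suc k)
  ≡ boundaryRoot m k ℤ.* boundaryRoot m k
boundaryRoot-step m k k≤m = trans
  (coefficient-difference-of-squares k (m ∸ k) ((2 ℕ.* m ℕ.+ 2) C (m ∸ k)) (ℕ.m+[n∸m]≡n k≤m))
  (cong (λ x → (+ (2 ℕ.* k ℕ.+ 1) ℤ.* + x) ℤ.* (+ (2 ℕ.* k ℕ.+ 1) ℤ.* + x))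
        (sym ([1+m∸k]*C-shift m k k≤m)))

boundary-step : ∀ m k → k ℕ.≤ m → summand m k + boundary m (suc k) ≡ boundary m k
boundary-step m k k≤m = begin
  summand m k + boundary m (suc k)
    ≡⟨ cong (_+ boundary m (suc k)) (/-*-/ a b d 1) ⟩
  (a ℤ.* b) / (d ℕ.* 1) + boundary m (suc k)
    -- Expanding the fraction by 2m+1 gives it the denominator of `boundary`.
    ≡⟨ cong (_+ boundary m (suc k)) (/-cross (a ℤ.* b) (+ s ℤ.* (a ℤ.* b)) (d ℕ.* 1) (s ℕ.* d) cross) ⟩
  (+ s ℤ.* (a ℤ.* b)) / (s ℕ.* d) + boundary m (suc k)
    ≡⟨ /-+-/ (+ s ℤ.* (a ℤ.* b)) _ (s ℕ.* d) ⟩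
  (+ s ℤ.* (a ℤ.* b) ℤ.+ boundaryRoot m (suc k) ℤ.* boundaryRoot m (suc k)) / (s ℕ.* d)
    ≡⟨ cong (λ x → x / (s ℕ.* d)) (boundaryRoot-step m k k≤m) ⟩
  boundary m k
    ∎
  where
  open ≡-Reasoning
  s = 1 ℕ.+ 2 ℕ.* m
  d = denominator m
  a = coefficient m k
  b = + (((2 ℕ.* m ℕ.+ 2) C (m ∸ k)) ℕ.^ 2)

  rearrange : ∀ s x d → x ℤ.* (s ℤ.* d) ≡ (s ℤ.* x) ℤ.* d
  rearrange = ℤ-Solver.solve-∀

  cross : (a ℤ.* b) ℤ.* + (s ℕ.* d) ≡ (+ s ℤ.* (a ℤ.* b)) ℤ.* + (d ℕ.* 1)
  cross rewrite ℕ.*-identityʳ d | ℤ.pos-* s d = rearrange (+ s) (a ℤ.* b) (+ d)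

-- The two ends of the telescope

-- Cross-multiplied, the claim is the square of `central-binomial-step`.
boundary-zero : ∀ m → catalan m * catalan m ≡ boundary m 0
boundary-zero m = trans (/-*-/ (+ c) (+ c) (suc m) (suc m))
  (/-cross (+ c ℤ.* + c) (boundaryRoot m 0 ℤ.* boundaryRoot m 0) (suc m ℕ.* suc m) (s ℕ.* denominator m) cross)
  where
  open ≡-Reasoning
  s = 1 ℕ.+ 2 ℕ.* m
  t = 2 ℕ.+ 2 ℕ.* m
  c = (2 ℕ.* m) C m
  x = suc m ℕ.* ((2 ℕ.* m ℕ.+ 2) C suc m)

  -- The final factor 1 comes from unfolding `t ^ 2`.
  square : ∀ s t c → (c ℕ.* c) ℕ.* (s ℕ.* (s ℕ.* (t ℕ.* (t ℕ.* 1)))) ≡ (s ℕ.* (t ℕ.* c)) ℕ.* (s ℕ.* (t ℕ.* c))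
  square = ℕ-Solver.solve-∀

  square′ : ∀ n x → (n ℕ.* x) ℕ.* (n ℕ.* x) ≡ (x ℕ.* x) ℕ.* (n ℕ.* n)
  square′ = ℕ-Solver.solve-∀

  cross-ℕ : (c ℕ.* c) ℕ.* (s ℕ.* denominator m) ≡ (x ℕ.* x) ℕ.* (suc m ℕ.* suc m)
  cross-ℕ = begin
    (c ℕ.* c) ℕ.* (s ℕ.* denominator m)      ≡⟨ square s t c ⟩
    (s ℕ.* (t ℕ.* c)) ℕ.* (s ℕ.* (t ℕ.* c))  ≡⟨ cong (λ y → y ℕ.* y) (central-binomial-step m) ⟨
    (suc m ℕ.* x) ℕ.* (suc m ℕ.* x)          ≡⟨ square′ (suc m) x ⟩
    (x ℕ.* x) ℕ.* (suc m ℕ.* suc m)          ∎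

  cross : (+ c ℤ.* + c) ℤ.* + (s ℕ.* denominator m) ≡
          (boundaryRoot m 0 ℤ.* boundaryRoot m 0) ℤ.* + (suc m ℕ.* suc m)
  cross = begin
    (+ c ℤ.* + c) ℤ.* + (s ℕ.* denominator m)
      ≡⟨ cong (ℤ._* + (s ℕ.* denominator m)) (ℤ.pos-* c c) ⟨
    + (c ℕ.* c) ℤ.* + (s ℕ.* denominator m)
      ≡⟨ ℤ.pos-* (c ℕ.* c) (s ℕ.* denominator m) ⟨
    + ((c ℕ.* c) ℕ.* (s ℕ.* denominator m))
      ≡⟨ cong +_ cross-ℕ ⟩
    + ((x ℕ.* x) ℕ.* (suc m ℕ.* suc m))
      ≡⟨ ℤ.pos-* (x ℕ.* x) (suc m ℕ.* suc m) ⟩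
    + (x ℕ.* x) ℤ.* + (suc m ℕ.* suc m)
      ≡⟨ cong (ℤ._* + (suc m ℕ.* suc m)) (ℤ.pos-* x x) ⟩
    (+ x ℤ.* + x) ℤ.* + (suc m ℕ.* suc m)
      -- At k = 0 the factor 2k+1 of `boundaryRoot` is 1.
      ≡⟨ cong (λ y → (y ℤ.* y) ℤ.* + (suc m ℕ.* suc m)) (ℤ.*-identityˡ (+ x)) ⟨
    (boundaryRoot m 0 ℤ.* boundaryRoot m 0) ℤ.* + (suc m ℕ.* suc m)
      ∎

boundary-last : ∀ m → boundary m (suc m) ≡ 0ℚ
boundary-last m
  -- `suc m ∸ suc m` reduces to `m ∸ m`; as a factor of `boundaryRoot` it makes the numerator 0.
  rewrite ℕ.n∸n≡0 m | ℤ.*-zeroʳ (+ (2 ℕ.* suc m ℕ.+ 1))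
  = /-cross (+ 0) (+ 0) ((1 ℕ.+ 2 ℕ.* m) ℕ.* denominator m) 1 refl

corollary3p7 : (m : ℕ) →
    catalan m * catalan m ≡
    ∑[ i ≤ m ]
    (let k = toℕ i in
    ((+ (2 ℕ.* k ℕ.+ 2) ℤ.* (+ (2 ℕ.* k ℕ.+ 1) ℤ.* + (2 ℕ.* k ℕ.+ 3) ℤ.- + (2 ℕ.* m ℕ.+ 1)))
    / ((1 ℕ.+ 2 ℕ.* m) ℕ.* (2 ℕ.+ 2 ℕ.* m) ℕ.^ 2))
    * (+ (((2 ℕ.* m ℕ.+ 2) C (m ∸ k)) ℕ.^ 2) / 1))
corollary3p7 m = begin
  catalan m * catalan m      ≡⟨ boundary-zero m ⟩
  boundary m 0               ≡⟨ sum-telescope (suc m) (summand m ∘ toℕ) (boundary m)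
                                  -- Indices in `Fin (suc m)` are at most m, so `m ∸ k` never
                                  -- truncates.
                                  (λ i → boundary-step m (toℕ i) (toℕ≤pred[n] i)) ⟨
  total + boundary m (suc m) ≡⟨ cong (λ x → total + x) (boundary-last m) ⟩
  total + 0ℚ                 ≡⟨ ℚ.+-identityʳ total ⟩
  total                      ∎
  where
  open ≡-Reasoning
  total = sum {suc m} (summand m ∘ toℕ)
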